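{- Let $G$ be a graph, $B$ a PSD forcing set of $G$ of size $k$, and $\mathcal F$ a propagating family of PSD forces for $B$ on $G$. Let $\mathcal H$ be the collection of subgraphs $H$ of $G$ such that $H=G\left[\bigcup_{P\in\mathcal Q}V(P)\right]$ for some path bundle $\mathcal Q$ of $\mathcal F$ induced by some $x\in V(G)$. Then $$\max_{H\in\mathcal H}\operatorname{pt}(H,B)\le\operatorname{pt}_+(G,B).$$ Moreover, if $\mathcal H'\subseteq\mathcal H$ is the collection of those $H$ arising from path bundles of $\mathcal F$ induced by vertices $x\in B^{(\operatorname{pt}_+(G,B))}$, then $$\operatorname{pt}_+(G,B)\le\min_{H\in\mathcal H'}|V(H)|-k.$$
   Context: All graphs are finite, simple and undirected. Each vertex is blue or white. Standard rule: a blue vertex $u$ with exactly one white neighbor $v$ can force $v$ to become blue. PSD rule: if $B$ is the current set of blue vertices, $C$ is a component of $G-B$, and $u\in B$ satisfies $N_G(u)\cap V(C)=\{v\}$, then $u$ can force $v$ to become blue ($u\to v$). For either rule and initial blue set $B$, put $B^{[0]}=B^{(0)}=B$; for $k\ge1$, $B^{(k)}$ is the set of all white vertices that can be forced when exactly $B^{[k-1]}$ is blue, and $B^{[k]}=B^{[k-1]}\cup B^{(k)}$. $B$ is a standard zero forcing set (resp. PSD forcing set) if $B^{[k]}=V(G)$ for some $k$; the least such $k$ is $\operatorname{pt}(G,B)$ (resp. $\operatorname{pt}_+(G,B)$). In the claim, $B^{(k)}$ refers to the PSD rule in $G$. A propagating family of PSD forces for $B$ is a family $\mathcal F=\{F^{(k)}\}_{k=1}^{t}$,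 $t=\operatorname{pt}_+(G,B)$, where $F^{(k)}$ contains, for each $u\in B^{(k)}$, exactly one force $v_u\to u$ with $v_u\in B^{[k-1]}$ that is valid when exactly $B^{[k-1]}$ is blue, and no other forces. For $x\in V(G)$, $\operatorname{rd}(x)$ is the unique $k$ with $x\in B^{(k)}$. Path bundle of $\mathcal F$ induced by $x$: for $0\le k\le\operatorname{rd}(x)-1$ let $C_x^k$ be the component of $G-B^{[k]}$ containing $x$. Let $B=\{v_i^0\}_{i=1}^{|B|}$ and let $Q_i^{[0]}$ be the one-vertex path on $v_i^0$. For each $i$, if $v_i^k\to w\in F^{(k+1)}$ for some $w\in V(C_x^k)$, put $v_i^{k+1}=w$ and obtain $Q_i^{[k+1]}$ by appending $w$ to the end of $Q_i^{[k]}$; otherwise put $v_i^{k+1}=v_i^k$ and $Q_i^{[k+1]}=Q_i^{[k]}$. The induced path bundle is $\mathcal Q=\{Q_i^{[\operatorname{rd}(x)]}\}_{i=1}^{|B|}$. -}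

module Defs where

open import Level using (0ℓ)
open import Data.Nat using (ℕ; zero; suc; _≤_; _<_)
open import Data.Fin using (Fin)
open import Data.Fin.Subset using (Subset; _∈_; _∩_; ⋃; ⁅_⁆; ∣_∣)
open import Data.Fin.Subset.Properties using (_∈?_; x∈p∩q⁺)
open import Data.List using (List; []; _∷_; _∷ʳ_; map; tabulate)
open import Data.Product using (_×_; _,_; ∃; ∃!; ∃-syntax)
open import Function.Bundles using (_⇔_)
open import Function.Definitions using (Injective)
open import Relation.Binary.Core using (Rel)
open import Relation.Binary.Definitions using (Symmetric; Decidable)
open import Relation.Binary.Construct.Closure.ReflexiveTransitive using (Star)
open import Relation.Binary.PropositionalEquality using (_≡_)
open import Relation.Nullary using (¬_; _×-dec_)
open import Relation.Unary using (Pred; _∪_; _≐_)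

-- Vertices are drawn from a common universe Fin n, with V(G) a subset of it,
-- so that a subgraph of G and a set B of vertices live over the same universe.
record Graph (n : ℕ) : Set₁ where
  infix 4 _~_ _~?_
  field
    V        : Subset n
    _~_      : Rel (Fin n) 0ℓ
    _~?_     : Decidable _~_
    ~-sym    : Symmetric _~_
    ~-irrefl : ∀ {u} → ¬ (u ~ u)
    ~⇒∈V     : ∀ {u v} → u ~ v → u ∈ V

_[_] : ∀ {n} → Graph n → Subset n → Graph n
G [ S ] = record
  { V        = V ∩ S
  ; _~_      = λ u v → u ~ v × u ∈ S × v ∈ S
  ; _~?_     = λ u v → (u ~? v) ×-dec (u ∈? S) ×-dec (v ∈? S)
  ; ~-sym    = λ (e , u∈S , v∈S) → ~-sym e , v∈S , u∈S
  ; ~-irrefl = λ (e , _) → ~-irrefl e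
  ; ~⇒∈V     = λ (e , u∈S , _) → x∈p∩q⁺ (~⇒∈V e , u∈S)
  }
  where open Graph G

module _ {n : ℕ} (G : Graph n) (Blue : Pred (Fin n) 0ℓ) where
  open Graph G

  White : Pred (Fin n) 0ℓ
  White v = v ∈ V × ¬ Blue v

  -- For c white, the vertex set of the component of G − Blue containing c.
  Component : Fin n → Pred (Fin n) 0ℓ
  Component c w = White c × Star (λ a b → White a × White b × a ~ b) c w

  StandardForce : Rel (Fin n) 0ℓ
  StandardForce u v = Blue u × (∀ w → (u ~ w × White w) ⇔ w ≡ v)

  -- Components of G − Blue are the sets Component c with c white;
  -- the condition on w says N(u) ∩ V(C) = {v}.
  PSDForce : Rel (Fin n) 0ℓ
  PSDForce u v =
    Blue u × ∃[ c ] (White c × (∀ w → (u ~ w × Component c w) ⇔ w ≡ v))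

Rule : Set₁
Rule = ∀ {n} → Graph n → Pred (Fin n) 0ℓ → Rel (Fin n) 0ℓ

module Propagation (R : Rule) {n : ℕ} (G : Graph n) (B : Subset n) where
  open Graph G

  mutual
    -- B^[ k ] is the set blue after k steps; B^⟨ k ⟩ is the set (usually written
    -- with round brackets) of vertices turning blue in step k.
    B^[_] : ℕ → Pred (Fin n) 0ℓ
    B^[ zero ]  = _∈ B
    B^[ suc k ] = B^[ k ] ∪ B^⟨ suc k ⟩

    B^⟨_⟩ : ℕ → Pred (Fin n) 0ℓ
    B^⟨ zero ⟩  = _∈ B
    B^⟨ suc k ⟩ = λ v → White G B^[ k ] v × ∃[ u ] R G B^[ k ] u v

  AllBlueAt : ℕ → Set
  AllBlueAt k = B^[ k ] ≐ (_∈ V)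

  IsForcingSet : Set
  IsForcingSet = ∃ AllBlueAt

  IsPropagationTime : ℕ → Set
  IsPropagationTime t = AllBlueAt t × (∀ j → AllBlueAt j → t ≤ j)

module Standard {n : ℕ} (G : Graph n) (B : Subset n) = Propagation StandardForce G B
module PSD {n : ℕ} (G : Graph n) (B : Subset n) = Propagation PSDForce G B

-- A family of sets of forces: F j v u says that v → u belongs to F^(j).
-- Only the indices 1 ≤ j ≤ pt₊(G,B) are constrained or used.
ForceFamily : ℕ → Set₁
ForceFamily n = ℕ → Rel (Fin n) 0ℓ

-- t is the index of the last set of forces, namely pt₊(G,B).
record IsPropagatingFamily {n : ℕ} (G : Graph n) (B : Subset n) (t : ℕ)
                           (F : ForceFamily n) : Set where
  open PSD G B
  field
    t-is-pt₊   : IsPropagationTime t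
    valid      : ∀ j → j < t → ∀ v u → F (suc j) v u →
                 B^⟨ suc j ⟩ u × PSDForce G B^[ j ] v u
    exactlyOne : ∀ j → j < t → ∀ u → B^⟨ suc j ⟩ u →
                 ∃! _≡_ (λ v → F (suc j) v u)

module _ {n : ℕ} (G : Graph n) (B : Subset n) (F : ForceFamily n) where
  open Graph G
  open PSD G B

  -- Trail x a k v P: started at a ∈ B, the path Q^[k] in the bundle induced by x
  -- has vertex sequence P and last vertex v.
  data Trail (x a : Fin n) : ℕ → Fin n → List (Fin n) → Set where
    start  : Trail x a 0 a (a ∷ [])
    extend : ∀ {k v P w} → Trail x a k v P →
             Component G B^[ k ] x w → F (suc k) v w →
             Trail x a (suc k) w (P ∷ʳ w)
    stay   : ∀ {k v P} → Trail x a k v P →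
             (∀ w → Component G B^[ k ] x w → ¬ F (suc k) v w) →
             Trail x a (suc k) v P

  -- Q i is the vertex sequence of the i-th path; v⁰ enumerates B without
  -- repetition, and r is rd(x).
  record IsPathBundle (x : Fin n) (Q : Fin ∣ B ∣ → List (Fin n)) : Set where
    field
      v⁰           : Fin ∣ B ∣ → Fin n
      v⁰-injective : Injective _≡_ _≡_ v⁰
      v⁰-image     : ∀ u → u ∈ B ⇔ (∃[ i ] v⁰ i ≡ u)
      r            : ℕ
      r-is-rd      : B^⟨ r ⟩ x
      trail        : ∀ i → ∃[ v ] Trail x (v⁰ i) r v (Q i)

  vertexSet : List (Fin n) → Subset n
  vertexSet P = ⋃ (map ⁅_⁆ P)

  bundleSubgraph : (Fin ∣ B ∣ → List (Fin n)) → Graph n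
  bundleSubgraph Q = G [ ⋃ (tabulate (λ i → vertexSet (Q i))) ]

  ArisesFrom : Fin n → Graph n → Set₁
  ArisesFrom x H = ∃[ Q ] (IsPathBundle x Q × H ≡ bundleSubgraph Q)

  𝓗 : Graph n → Set₁
  𝓗 H = ∃[ x ] (x ∈ V × ArisesFrom x H)

  -- t is pt₊(G,B).
  𝓗′ : ℕ → Graph n → Set₁
  𝓗′ t H = ∃[ x ] (B^⟨ t ⟩ x × ArisesFrom x H)

{-# OPTIONS --safe #-}
module Submission where

-- Write C_x^k for the component of G − B^[k] containing x and let r = rd(x).
--
-- Upper bound on pt(H,B): by induction on k, the vertices on the paths at step k
-- are standard-blue in H after k steps.  All later vertices of the paths lie in
-- C_x^k, so when v PSD-forces w into C_x^k, no vertex of H other than w can be a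
-- white neighbour of v in H.  Hence H is blue after r ≤ pt₊(G,B) steps.
--
-- Lower bound on |V(H)|: as long as x is white, some vertex of C_x^k is forced in
-- step k + 1, since otherwise C_x^k would stay white forever.  Every blue
-- neighbour of C_x^k is the current end of one of the paths, so that vertex is
-- appended to a path.  Thus the paths gain at least one vertex in each of r steps.

open import Level using (0ℓ)
open import Data.Nat using (ℕ; zero; suc; _+_; _≤_; _<_; z≤n; s≤s; s≤s⁻¹; _≤′_; ≤′-refl; ≤′-step)
open import Data.Nat.Properties
  using (≤-refl; ≤-trans; ≤-reflexive; <⇒≤; ≮⇒≥; ≤⇒≤′; m≤n⇒m<n∨m≡n; _≤?_;
         m≤m+n; +-monoʳ-≤; m+n≤o⇒m≤o∸n; anyUpTo?; +-suc; +-identityʳ; +-comm)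
open import Data.Nat.Induction using (<-rec)
open import Data.Integer using (+_; _-_; +≤+) renaming (_≤_ to _≤ℤ_)
open import Data.Integer.Properties using (m-n≡m⊖n; ⊖-≥)
open import Data.Fin using (Fin)
open import Data.Fin.Properties using (_≟_; all?; any?)
open import Data.Fin.Subset using (Subset; _∈_; _⊆_; _∪_; _∩_; ⋃; ⁅_⁆; ∣_∣)
open import Data.Fin.Subset.Properties
  using (_∈?_; ∉⊥; x∈⁅x⁆; x∈⁅y⁆⇒x≡y; x∈p∩q⁺; x∈p∩q⁻; x∈p∪q⁺; x∈p∪q⁻; p⊆p∪q;
         p⊂q⇒∣p∣<∣q∣; p⊆q⇒∣p∣≤∣q∣)
open import Data.List using (List; []; _∷_; _∷ʳ_; tabulate)
open import Data.List.Membership.Propositional using () renaming (_∈_ to _∈ᴸ_)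
open import Data.List.Membership.Propositional.Properties
  using (∈-++⁺ˡ; ∈-++⁺ʳ; ∈-++⁻; ∈-map⁺; ∈-map⁻; ∈-tabulate⁺; ∈-tabulate⁻)
open import Data.List.Relation.Unary.Any using (here; there)
open import Data.Product using (_×_; _,_; proj₁; proj₂; ∃-syntax; ∃₂)
open import Data.Sum using (_⊎_; inj₁; inj₂)
open import Function using (_∘_)
open import Function.Bundles using (_⇔_; mk⇔; Equivalence)
open import Relation.Binary.Construct.Closure.ReflexiveTransitive
  using (Star; ε; _◅_; _◅◅_; reverse; gmap)
open import Relation.Binary.PropositionalEquality using (_≡_; refl; sym)
open import Relation.Nullary
  using (¬_; Dec; yes; no; contradiction; ¬?; _×-dec_; _⊎-dec_; _→-dec_; decidable-stable)
open import Relation.Nullary.Decidable using (map′)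
open import Relation.Unary using (Pred; Decidable)
open import Defs

open Equivalence using (to; from)

-- Least numbers, unions and finite subsets.

-- Turns some step at which `H` is entirely blue into its propagation time, which is by definition a
-- least such step.
least : {P : Pred ℕ 0ℓ} → Decidable P → ∀ {m} → P m →
        ∃[ p ] ((P p × (∀ j → P j → p ≤ j)) × p ≤ m)
least {P} P? {m} = <-rec Least step m
  where
  Least : Pred ℕ 0ℓ
  Least m = P m → ∃[ p ] ((P p × (∀ j → P j → p ≤ j)) × p ≤ m)

  step : ∀ m → (∀ {j} → j < m → Least j) → Least m
  step m rec Pm with anyUpTo? P? m
  ... | yes (j , j<m , Pj) with p , p-least , p≤j ← rec j<m Pj =
    p , p-least , ≤-trans p≤j (<⇒≤ j<m)
  ... | no ∄smaller =
    m , (Pm , λ j Pj → ≮⇒≥ (λ j<m → ∄smaller (j , j<m , Pj))) , ≤-refl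

x∈⋃⁺ : ∀ {n} {x : Fin n} {S} {Ss : List (Subset n)} → S ∈ᴸ Ss → x ∈ S → x ∈ ⋃ Ss
x∈⋃⁺ (here refl)  x∈S = x∈p∪q⁺ (inj₁ x∈S)
x∈⋃⁺ (there S∈Ss) x∈S = x∈p∪q⁺ (inj₂ (x∈⋃⁺ S∈Ss x∈S))

x∈⋃⁻ : ∀ {n} {x : Fin n} (Ss : List (Subset n)) → x ∈ ⋃ Ss → ∃[ S ] (S ∈ᴸ Ss × x ∈ S)
x∈⋃⁻ []       x∈⊥ = contradiction x∈⊥ ∉⊥
x∈⋃⁻ (S ∷ Ss) x∈ with x∈p∪q⁻ S (⋃ Ss) x∈
... | inj₁ x∈S = S , here refl , x∈S
... | inj₂ x∈⋃ with T , T∈Ss , x∈T ← x∈⋃⁻ Ss x∈⋃ = T , there T∈Ss , x∈T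

p∪⁅x⁆-elim : ∀ {n} {S : Subset n} {w} {P : Pred (Fin n) 0ℓ} →
             (∀ {u} → u ∈ S → P u) → P w → ∀ {u} → u ∈ S ∪ ⁅ w ⁆ → P u
p∪⁅x⁆-elim {S = S} {w} S⊆P Pw u∈ with x∈p∪q⁻ S ⁅ w ⁆ u∈
... | inj₁ u∈S = S⊆P u∈S
... | inj₂ u∈w with refl ← x∈⁅y⁆⇒x≡y w u∈w = Pw

∣p∣<∣p∪⁅x⁆∣ : ∀ {n} {w : Fin n} {S} → ¬ w ∈ S → ∣ S ∣ < ∣ S ∪ ⁅ w ⁆ ∣
∣p∣<∣p∪⁅x⁆∣ {w = w} {S} w∉S =
  p⊂q⇒∣p∣<∣q∣ (p⊆p∪q ⁅ w ⁆ , w , x∈p∪q⁺ (inj₂ (x∈⁅x⁆ w)) , w∉S)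

_⇔-dec_ : ∀ {A B : Set} → Dec A → Dec B → Dec (A ⇔ B)
a? ⇔-dec b? =
  map′ (λ (f , g) → mk⇔ f g) (λ e → to e , from e) ((a? →-dec b?) ×-dec (b? →-dec a?))

-- Components and forces for a fixed blue set.

module _ {n} (G : Graph n) {Blue : Pred (Fin n) 0ℓ} where
  open Graph G

  White? : Decidable Blue → Decidable (White G Blue)
  White? blue? v = (v ∈? V) ×-dec ¬? (blue? v)

  StandardForce? : Decidable Blue → ∀ u v → Dec (StandardForce G Blue u v)
  StandardForce? blue? u v =
    blue? u ×-dec all? (λ w → ((u ~? w) ×-dec White? blue? w) ⇔-dec (w ≟ v))

  private
    reverseWalk : ∀ {a b} → Star (λ a b → White G Blue a × White G Blue b × a ~ b) a b →
                  Star (λ a b → White G Blue a × White G Blue b × a ~ b) b a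
    reverseWalk = reverse (λ (wa , wb , e) → wb , wa , ~-sym e)

  component-white : ∀ {c w} → Component G Blue c w → White G Blue w
  component-white (wc , walk) with reverseWalk walk
  ... | ε               = wc
  ... | (ww , _) ◅ _    = ww

  component-refl : ∀ {c} → White G Blue c → Component G Blue c c
  component-refl wc = wc , ε

  component-sym : ∀ {c w} → Component G Blue c w → Component G Blue w c
  component-sym comp = component-white comp , reverseWalk (proj₂ comp)

  component-trans : ∀ {a b c} → Component G Blue a b → Component G Blue b c → Component G Blue a c
  component-trans (wa , p) (_ , q) = wa , p ◅◅ q

  component-step : ∀ {c v w} → Component G Blue c v → White G Blue w → v ~ w → Component G Blue c w
  component-step comp ww e =
    component-trans comp (component-white comp , (component-white comp , ww , e) ◅ ε)

  PSDForce⇒~ : ∀ {u v} → PSDForce G Blue u v → u ~ v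
  PSDForce⇒~ (_ , _ , _ , unique) = proj₁ (from (unique _) refl)

  -- The component `c` hidden in a PSD force contains the forced vertex `v`, so it coincides with
  -- the component of any `x` that reaches `v`. The force can thus be read relative to `x`.
  PSDForce-unique : ∀ {u v x w} → PSDForce G Blue u v → Component G Blue x v →
                    u ~ w → Component G Blue x w → w ≡ v
  PSDForce-unique {v = v} (_ , c , _ , unique) xv u~w xw =
    to (unique _) (u~w , component-trans cv (component-trans (component-sym xv) xw))
    where
    cv : Component G Blue c v
    cv = proj₂ (from (unique v) refl)

component-antitone : ∀ {n} (G : Graph n) {Blue Blue′ : Pred (Fin n) 0ℓ} →
                     (∀ {v} → Blue v → Blue′ v) →
                     ∀ {c w} → Component G Blue′ c w → Component G Blue c w
component-antitone G {Blue} {Blue′} sub (wc , walk) =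
  white wc , gmap (λ v → v) (λ (wa , wb , e) → white wa , white wb , e) walk
  where
  white : ∀ {v} → White G Blue′ v → White G Blue v
  white (v∈V , ¬b) = v∈V , ¬b ∘ sub

-- Decidability and monotonicity of propagation.

module _ {n} (H : Graph n) (B : Subset n) where
  open Standard H B

  -- The standard rule quantifies only over finitely many vertices. Both the search for a least step
  -- and the case split in `trail-blue` rest on this.
  B^[_]? : ∀ k → Decidable B^[ k ]
  B^[ zero ]?  v = v ∈? B
  B^[ suc k ]? v =
    B^[ k ]? v ⊎-dec
    (White? H B^[ k ]? v ×-dec any? (λ u → StandardForce? H B^[ k ]? u v))

  AllBlueAt? : Decidable AllBlueAt
  AllBlueAt? k =
    map′ (λ f → (λ {v} → to (f v)) , (λ {v} → from (f v)))
         (λ (f , g) v → mk⇔ f g)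
         (all? (λ v → B^[ k ]? v ⇔-dec (v ∈? Graph.V H)))

module _ (R : Rule) {n} (G : Graph n) (B : Subset n) where
  open Propagation R G B

  B^[]-mono : ∀ {j k} → j ≤ k → ∀ {v} → B^[ j ] v → B^[ k ] v
  B^[]-mono = go ∘ ≤⇒≤′
    where
    go : ∀ {j k} → j ≤′ k → ∀ {v} → B^[ j ] v → B^[ k ] v
    go ≤′-refl       b = b
    go (≤′-step j≤k) b = inj₁ (go j≤k b)

  B^⟨⟩⊆B^[] : ∀ k {v} → B^⟨ k ⟩ v → B^[ k ] v
  B^⟨⟩⊆B^[] zero    b = b
  B^⟨⟩⊆B^[] (suc k) b = inj₂ b

  B^[]⊆V : (∀ {v} → v ∈ B → v ∈ Graph.V G) → ∀ k {v} → B^[ k ] v → v ∈ Graph.V G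
  B^[]⊆V B⊆V zero    b                    = B⊆V b
  B^[]⊆V B⊆V (suc k) (inj₁ b)             = B^[]⊆V B⊆V k b
  B^[]⊆V B⊆V (suc k) (inj₂ ((v∈V , _) , _)) = v∈V

  white-before : ∀ {r x} → B^⟨ r ⟩ x → ∀ {k} → k < r → White G B^[ k ] x
  white-before {suc r} ((x∈V , ¬b) , _) (s≤s k≤r) = x∈V , ¬b ∘ B^[]-mono k≤r

-- Progress inside the component of a white vertex.

module _ {n} (G : Graph n) (B : Subset n) where
  open Graph G
  open PSD G B

  -- If no vertex of the component C is forced at step k + 1, then C and its
  -- blue neighbours never change again.
  component-stalls : ∀ {k x} → (∀ w → Component G B^[ k ] x w → ¬ B^⟨ suc k ⟩ w) →
                     ∀ {m} → k ≤′ m → ∀ w → Component G B^[ k ] x w → ¬ B^[ m ] w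
  component-stalls stuck ≤′-refl w xw b = proj₂ (component-white G xw) b
  component-stalls stuck (≤′-step k≤m) w xw (inj₁ b) =
    component-stalls stuck k≤m w xw b
  component-stalls {k} {x} stuck {suc m} (≤′-step k≤m) w xw
    (inj₂ (wm , u , force@(u∈B^[m] , _))) =
    -- The component is unchanged up to step `m`, so a forcer `u` that was blue at step `k` could
    -- already have forced `w` then, with `w` itself naming the component.
    ¬¬blue (λ u∈B^[k] → stuck w xw
      (ww , u , u∈B^[k] , w , ww ,
       λ w′ → mk⇔ (λ (u~w′ , _ , walk) →
                      PSDForce-unique G force (component-refl G wm) u~w′ (persists xw walk))
                  (λ { refl → PSDForce⇒~ G force , component-refl G ww })))
    where
    ww : White G B^[ k ] w
    ww = component-white G xw

    u∈V : u ∈ V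
    u∈V = ~⇒∈V (PSDForce⇒~ G force)

    ¬¬blue : ¬ ¬ B^[ k ] u
    -- A white neighbour of `w` lies in the stalled component, so by induction it cannot be blue at
    -- step `m`.
    ¬¬blue ¬b = component-stalls stuck k≤m u
      (component-step G xw (u∈V , ¬b) (~-sym (PSDForce⇒~ G force))) u∈B^[m]

    still-white : ∀ {v} → Component G B^[ k ] x v → White G B^[ m ] v
    still-white {v} xv = proj₁ (component-white G xv) , component-stalls stuck k≤m v xv

    persists : ∀ {v v′} → Component G B^[ k ] x v →
               Star (λ a b → White G B^[ k ] a × White G B^[ k ] b × a ~ b) v v′ →
               Component G B^[ m ] v v′
    persists xv ε = component-refl G (still-white xv)
    persists xv ((_ , wb , e) ◅ walk) =
      component-trans G
        (component-step G (component-refl G (still-white xv)) (still-white xb) e)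
        (persists xb walk)
      where
      xb = component-step G xv wb e

  -- A stalled component would keep `x` white at step `r`.
  component-forced : ∀ {r x} → B^⟨ r ⟩ x → ∀ {k} → k < r →
                     ¬ ¬ (∃[ w ] (Component G B^[ k ] x w × B^⟨ suc k ⟩ w))
  component-forced {r} {x} rx {k} k<r none =
    component-stalls (λ w xw fw → none (w , xw , fw)) (≤⇒≤′ (<⇒≤ k<r)) x
      (component-refl G (white-before PSDForce G B rx k<r))
      (B^⟨⟩⊆B^[] PSDForce G B r rx)

-- Trails and their prefixes.

module _ {n} (G : Graph n) (B : Subset n) (F : ForceFamily n) where
  open Graph G
  open PSD G B

  trail-last : ∀ {x a k v P} → Trail G B F x a k v P → v ∈ᴸ P
  trail-last start                    = here refl
  trail-last (extend {P = P} tr c f) = ∈-++⁺ʳ P (here refl)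
  trail-last (stay tr _)              = trail-last tr

  trail-first : ∀ {x a k v P} → Trail G B F x a k v P → a ∈ᴸ P
  trail-first start           = here refl
  trail-first (extend tr c f) = ∈-++⁺ˡ (trail-first tr)
  trail-first (stay tr _)     = trail-first tr

  -- A vertex appended after step `k` was taken from a later component of `x`, and these components
  -- only shrink as more vertices turn blue.
  trail-prefix : ∀ {x a r v P} → Trail G B F x a r v P → ∀ {k} → k ≤ r →
                 ∃₂ λ v′ P′ → Trail G B F x a k v′ P′ × (∀ {u} → u ∈ᴸ P′ → u ∈ᴸ P) ×
                   (∀ {u} → u ∈ᴸ P → u ∈ᴸ P′ ⊎ Component G B^[ k ] x u)
  trail-prefix {P = P} tr k≤r with m≤n⇒m<n∨m≡n k≤r
  ... | inj₂ refl = _ , _ , tr , (λ u∈ → u∈) , inj₁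
  trail-prefix (extend {P = P} tr xw f) {k} _ | inj₁ (s≤s k≤r)
    with v′ , P′ , tr′ , sub , split ← trail-prefix tr k≤r =
    v′ , P′ , tr′ , ∈-++⁺ˡ ∘ sub , split′
    where
    split′ : ∀ {u} → u ∈ᴸ P ∷ʳ _ → u ∈ᴸ P′ ⊎ Component G B^[ k ] _ u
    split′ u∈ with ∈-++⁻ P u∈
    ... | inj₁ u∈P         = split u∈P
    ... | inj₂ (here refl) = inj₂ (component-antitone G (B^[]-mono PSDForce G B k≤r) xw)
  trail-prefix (stay tr _) _ | inj₁ (s≤s k≤r) = trail-prefix tr k≤r

  ∈-bundle⁺ : ∀ {Q : Fin ∣ B ∣ → List (Fin n)} {u} i → u ∈ᴸ Q i →
              u ∈ ⋃ (tabulate (λ i → vertexSet G B F (Q i)))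
  ∈-bundle⁺ {u = u} i u∈Qi = x∈⋃⁺ (∈-tabulate⁺ i) (x∈⋃⁺ (∈-map⁺ ⁅_⁆ u∈Qi) (x∈⁅x⁆ u))

  ∈-bundle⁻ : ∀ {Q : Fin ∣ B ∣ → List (Fin n)} {u} →
              u ∈ ⋃ (tabulate (λ i → vertexSet G B F (Q i))) → ∃[ i ] u ∈ᴸ Q i
  ∈-bundle⁻ {Q} u∈
    with S , S∈ , u∈S ← x∈⋃⁻ _ u∈
    with i , refl ← ∈-tabulate⁻ {f = λ i → vertexSet G B F (Q i)} S∈
    with T , T∈ , u∈T ← x∈⋃⁻ _ u∈S
    with v , v∈Qi , refl ← ∈-map⁻ ⁅_⁆ T∈
    with refl ← x∈⁅y⁆⇒x≡y v u∈T = i , v∈Qi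

  module _ {t} (family : IsPropagatingFamily G B t F) where
    open IsPropagatingFamily family

    B⊆V : ∀ {v} → v ∈ B → v ∈ V
    B⊆V v∈B = proj₁ (proj₁ t-is-pt₊) (B^[]-mono PSDForce G B {k = t} z≤n v∈B)

    rd≤pt₊ : ∀ {r x} → B^⟨ r ⟩ x → r ≤ t
    rd≤pt₊ {zero}  rx = z≤n
    rd≤pt₊ {suc r} ((x∈V , ¬b) , _) = ≮⇒≥ λ t<1+r →
      ¬b (B^[]-mono PSDForce G B (s≤s⁻¹ t<1+r) (proj₂ (proj₁ t-is-pt₊) x∈V))

    -- The two bounds for a single path bundle.

    module _ {x} {Q : Fin ∣ B ∣ → List (Fin n)} (bundle : IsPathBundle G B F x Q) where
      open IsPathBundle bundle

      private
        U : Subset n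
        U = ⋃ (tabulate (λ i → vertexSet G B F (Q i)))

        H : Graph n
        H = bundleSubgraph G B F Q

      open Standard H B using () renaming (B^[_] to B^ᴴ[_]; AllBlueAt to AllBlueAtᴴ)

      private
        U⁺ : ∀ {u} i → u ∈ᴸ Q i → u ∈ U
        U⁺ i = ∈-bundle⁺ {Q} i

        r≤t : r ≤ t
        r≤t = rd≤pt₊ r-is-rd

        v⁰∈B : ∀ i → v⁰ i ∈ B
        v⁰∈B i = from (v⁰-image _) (i , refl)

        B⊆U : ∀ {u} → u ∈ B → u ∈ U
        B⊆U u∈B with i , refl ← to (v⁰-image _) u∈B =
          U⁺ i (trail-first (proj₂ (trail i)))

      -- Stated for every trail inside `U`, not only for prefixes of one path: excluding a second
      -- white neighbour needs the induction hypothesis on the other paths at the same step.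
      trail-blue : ∀ k → k ≤ r → ∀ {a v P} → a ∈ B → Trail G B F x a k v P →
                   (∀ {u} → u ∈ᴸ P → u ∈ U) → ∀ {u} → u ∈ᴸ P → B^ᴴ[ k ] u
      trail-blue .0 _ a∈B start _ (here refl) = a∈B
      trail-blue (suc k) k<r a∈B (stay tr _) P⊆U u∈P =
        inj₁ (trail-blue k (<⇒≤ k<r) a∈B tr P⊆U u∈P)
      trail-blue (suc k) k<r a∈B (extend {v = v} {P = P} {w = w} tr xw f) P⊆U u∈
        with ∈-++⁻ P u∈
      ... | inj₁ u∈P = inj₁ (trail-blue k (<⇒≤ k<r) a∈B tr (P⊆U ∘ ∈-++⁺ˡ) u∈P)
      ... | inj₂ (here refl) with B^[_]? H B k w
      -- Standard forcing in `H` may run ahead of the PSD process, so `w` may be blue already.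
      ... | yes w-blue = inj₁ w-blue
      ... | no ¬w-blue = inj₂ (w-white , v , v-blue , λ w′ →
              mk⇔ (only w′) (λ { refl → (PSDForce⇒~ G force , v∈U , w∈U) , w-white }))
        where
        force : PSDForce G B^[ k ] v w
        force = proj₂ (valid k (≤-trans k<r r≤t) v w f)

        w∈U : w ∈ U
        w∈U = P⊆U u∈

        v∈U : v ∈ U
        v∈U = P⊆U (∈-++⁺ˡ (trail-last tr))

        w-white : White H B^ᴴ[ k ] w
        w-white = x∈p∩q⁺ (proj₁ (component-white G xw) , w∈U) , ¬w-blue

        v-blue : B^ᴴ[ k ] v
        v-blue = trail-blue k (<⇒≤ k<r) a∈B tr (P⊆U ∘ ∈-++⁺ˡ) (trail-last tr)

        only : ∀ w′ → Graph._~_ H v w′ × White H B^ᴴ[ k ] w′ → w′ ≡ w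
        only w′ ((v~w′ , _ , w′∈U) , _ , ¬w′-blue)
          with i , w′∈Qi ← ∈-bundle⁻ {Q} w′∈U
          with _ , _ , tr′ , sub , split ← trail-prefix (proj₂ (trail i)) (<⇒≤ k<r)
          with split w′∈Qi
        -- A vertex of `H` is either on a path by step `k`, hence blue by induction, or in the
        -- component of `x`, where `v` has `w` as its only neighbour.
        ... | inj₁ w′∈P′ =
          contradiction (trail-blue k (<⇒≤ k<r) (v⁰∈B i) tr′ (U⁺ i ∘ sub) w′∈P′) ¬w′-blue
        ... | inj₂ xw′ = PSDForce-unique G force xw v~w′ xw′

      bundle-blue : AllBlueAtᴴ r
      bundle-blue =
        B^[]⊆V StandardForce H B (λ u∈B → x∈p∩q⁺ (B⊆V u∈B , B⊆U u∈B)) r , blue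
        where
        blue : ∀ {u} → u ∈ Graph.V H → B^ᴴ[ r ] u
        blue u∈H with i , u∈Qi ← ∈-bundle⁻ {Q} (proj₂ (x∈p∩q⁻ V U u∈H)) =
          trail-blue r ≤-refl (v⁰∈B i) (proj₂ (trail i)) (U⁺ i) u∈Qi

      pt≤pt₊ : ∃[ p ] (Standard.IsPropagationTime H B p × p ≤ t)
      pt≤pt₊ with p , p-is-pt , p≤r ← least (AllBlueAt? H B) bundle-blue =
        p , p-is-pt , ≤-trans p≤r r≤t

      -- Induction on `k`. A trail ending at an old boundary vertex `u` must stay there, and a newly
      -- forced `u` is reached from its forcer, which was a boundary vertex one step before.
      -- Quantifying over all trails from `v⁰ i` lets the result apply to whichever prefix
      -- `trail-prefix` returns.
      boundary-ends : ∀ k → k ≤ r → ∀ {u y} → B^[ k ] u → u ~ y → Component G B^[ k ] x y →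
                      ∃[ i ] (∀ {v P} → Trail G B F x (v⁰ i) k v P → v ≡ u)
      boundary-ends zero _ u∈B u~y xy with i , refl ← to (v⁰-image _) u∈B =
        i , λ { start → refl }
      boundary-ends (suc k) k<r {u} {y} (inj₁ u-blue) u~y xy
        with xy′ ← component-antitone G inj₁ xy
        with i , ends ← boundary-ends k (<⇒≤ k<r) u-blue u~y xy′ =
        i , λ { (stay tr _) → ends tr ; (extend tr xw f) → absurd tr xw f }
        where
        absurd : ∀ {v P w} {A : Set} → Trail G B F x (v⁰ i) k v P →
                 Component G B^[ k ] x w → F (suc k) v w → A
        -- Leaving `u` would force its neighbour `y`, which is still white after step `k + 1`.
        absurd tr xw f with refl ← ends tr
          with w-forced , force ← valid k (≤-trans k<r r≤t) _ _ f
          with refl ← PSDForce-unique G force xw u~y xy′ =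
          contradiction (inj₂ w-forced) (proj₂ (component-white G xy))
      boundary-ends (suc k) k<r {u} {y} (inj₂ u-forced) u~y xy
        with v , vFu , _ ← exactlyOne k (≤-trans k<r r≤t) u u-forced
        with _ , force ← valid k (≤-trans k<r r≤t) v u vFu
        with xu ← component-step G (component-antitone G inj₁ xy) (proj₁ u-forced) (~-sym u~y)
        with i , ends ← boundary-ends k (<⇒≤ k<r) (proj₁ force) (PSDForce⇒~ G force) xu =
        i , λ { (stay tr ¬F) → absurd tr ¬F ; (extend tr xw f) → same tr xw f }
        where
        absurd : ∀ {v′ P} {A : Set} → Trail G B F x (v⁰ i) k v′ P →
                 (∀ w → Component G B^[ k ] x w → ¬ F (suc k) v′ w) → A
        absurd tr ¬F with refl ← ends tr = contradiction vFu (¬F u xu)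

        same : ∀ {v′ P w} → Trail G B F x (v⁰ i) k v′ P →
               Component G B^[ k ] x w → F (suc k) v′ w → w ≡ u
        same tr xw f with refl ← ends tr
          with _ , force′ ← valid k (≤-trans k<r r≤t) _ _ f =
          sym (PSDForce-unique G force′ xw (PSDForce⇒~ G force) xu)

      -- The forcer of `w` is a boundary vertex, hence the end of some trail. That trail cannot
      -- stay, and the only vertex it can append is `w`.
      forced-in-bundle : ∀ k → k < r → ∀ {w} → Component G B^[ k ] x w → B^⟨ suc k ⟩ w → w ∈ U
      forced-in-bundle k k<r {w} xw w-forced
        with v , vFw , _ ← exactlyOne k (≤-trans k<r r≤t) w w-forced
        with _ , force ← valid k (≤-trans k<r r≤t) v w vFw
        with i , ends ← boundary-ends k (<⇒≤ k<r) (proj₁ force) (PSDForce⇒~ G force) xw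
        -- Here `k<r` serves as `suc k ≤ r`: the prefix taken is the one just after `w` is forced,
        -- and its last constructor shows the move.
        with trail-prefix (proj₂ (trail i)) k<r
      ... | _ , _ , stay tr ¬F , _ with refl ← ends tr = contradiction vFw (¬F w xw)
      ... | _ , _ , extend {P = P} tr xw′ f , sub , _
        with refl ← ends tr
        with _ , force′ ← valid k (≤-trans k<r r≤t) _ _ f
        with refl ← PSDForce-unique G force′ xw′ (PSDForce⇒~ G force) xw =
        U⁺ i (sub (∈-++⁺ʳ P (here refl)))

      -- Double negation, because it is not decided which vertex of C_x^k is
      -- forced next; the inequality drawn from it is decidable.
      bundle-grows : ∀ k → k ≤ r →
                     ¬ ¬ (∃[ S ] (S ⊆ V ∩ U × (∀ {u} → u ∈ S → B^[ k ] u) × ∣ B ∣ + k ≤ ∣ S ∣))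
      bundle-grows zero _ none =
        none (B , (λ u∈B → x∈p∩q⁺ (B⊆V u∈B , B⊆U u∈B)) , (λ u∈B → u∈B) ,
              ≤-reflexive (+-identityʳ ∣ B ∣))
      bundle-grows (suc k) k<r none =
        bundle-grows k (<⇒≤ k<r) λ (S , S⊆H , S-blue , size) →
        component-forced G B r-is-rd k<r λ (w , xw , w-forced) →
        none (S ∪ ⁅ w ⁆ ,
              p∪⁅x⁆-elim S⊆H (x∈p∩q⁺ (proj₁ (component-white G xw) ,
                                      forced-in-bundle k k<r xw w-forced)) ,
              p∪⁅x⁆-elim (inj₁ ∘ S-blue) (inj₂ w-forced) ,
              ≤-trans (≤-reflexive (+-suc ∣ B ∣ k))
                (≤-trans (s≤s size) (∣p∣<∣p∪⁅x⁆∣ (proj₂ (component-white G xw) ∘ S-blue))))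

      ∣B∣+rd≤∣H∣ : ∣ B ∣ + r ≤ ∣ Graph.V H ∣
      ∣B∣+rd≤∣H∣ = decidable-stable (_ ≤? _) λ ≰ →
        bundle-grows r ≤-refl λ (S , S⊆H , _ , size) → ≰ (≤-trans size (p⊆q⇒∣p∣≤∣q∣ S⊆H))

      pt₊≤∣H∣-∣B∣ : B^⟨ t ⟩ x → + t ≤ℤ (+ ∣ Graph.V H ∣) - (+ ∣ B ∣)
      pt₊≤∣H∣-∣B∣ x∈B^⟨t⟩
        -- Since `∣ B ∣` is at most `∣ Graph.V H ∣`, the integer difference is the natural one.
        rewrite m-n≡m⊖n ∣ Graph.V H ∣ ∣ B ∣
              | ⊖-≥ (≤-trans (m≤m+n ∣ B ∣ r) ∣B∣+rd≤∣H∣) =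
        +≤+ (m+n≤o⇒m≤o∸n t
          (≤-trans (≤-reflexive (+-comm t ∣ B ∣)) (≤-trans (+-monoʳ-≤ ∣ B ∣ t≤r) ∣B∣+rd≤∣H∣)))
        where
        t≤r : t ≤ r
        -- The bundle carries its own round `r` for `x`; a vertex turning blue in round `t` is white
        -- at every earlier step.
        t≤r = ≮⇒≥ λ r<t →
          proj₂ (white-before PSDForce G B x∈B^⟨t⟩ r<t) (B^⟨⟩⊆B^[] PSDForce G B r r-is-rd)

corollary5p9 : ∀ {n : ℕ} (G : Graph n) (B : Subset n) (k : ℕ) (t : ℕ) (F : ForceFamily n) →
    PSD.IsForcingSet G B → ∣ B ∣ ≡ k →
    PSD.IsPropagationTime G B t →
    IsPropagatingFamily G B t F →
    (∀ H → 𝓗 G B F H → ∃[ p ] (Standard.IsPropagationTime H B p × p ≤ t)) ×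
    (∀ H → 𝓗′ G B F t H → + t ≤ℤ (+ ∣ Graph.V H ∣) - (+ k))
corollary5p9 G B k t F _ refl _ family =
  (λ { _ (_ , _ , _ , bundle , refl) → pt≤pt₊ G B F family bundle }) ,
  (λ { _ (_ , x∈B^⟨t⟩ , _ , bundle , refl) → pt₊≤∣H∣-∣B∣ G B F family bundle x∈B^⟨t⟩ })
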